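{- Let $m>2^{16}$ be an integer and let $k\ge1$ be an integer such that $k\le\frac12\sqrt{\log_2 m/\log_2\log_2 m}$. Let $n\ge 1$ be an integer with $n\le(\log_2 m)^{k/3}$. Then $\chi^n(m)\le(2k-1)n$; that is, there is an algorithm that loads any $n$ keys, presented online, into an array of size $m$ with amortized cost at most $2k-1$ per key.
   Context: Interval notation denotes sets of integers. For a finite set $Y$ of integers ("keys"), a storage function for $Y$ is a strictly order preserving map $f:Y\to[1,m]$ ($x<y$ implies $f(x)<f(y)$); $[1,m]$ is the set of cells of an array of size $m$. The online labeling (array loading) game with $n$ keys and array size $m\ge n$ is played by an adversary and a (deterministic) algorithm in $n$ steps. At step $t\in[1,n]$ the adversary selects an integer key $y^t\notin\{y^1,\dots,y^{t-1}\}$, and the algorithm, before seeing later keys, responds with a storage function $f^t$ for the set $Y^t=\{y^1,\dots,y^t\}$. A key $y\in Y^t$ is relocated at step $t$ if $y=y^t$ or $f^t(y)\ne f^{t-1}(y)$; $Rel^t$ is the set of keys relocated at step $t$. The total cost is $\sum_{t=1}^n|Rel^t|$. $\chi^n(m)$ denotes the smallest worst-case total cost that an algorithm can achieve against the best adversary, with no bound on the range from which the keys are taken; amortized cost per key means total cost divided by $n$. -}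

module Defs where

open import Algebra.Definitions.RawSemiring using () renaming (_^_ to pow)
open import Data.Integer.Base as ℤ using (ℤ; +_; -[1+_])
import Data.Integer.Properties as ℤ
open import Data.List.Base using (List; []; _∷_; map; filter; length)
open import Data.List.Membership.Propositional using (_∈_; _∉_)
open import Data.List.Relation.Unary.Unique.Propositional using (Unique)
open import Data.Nat.Base using (ℕ; zero; suc; _+_; _≤_; _<_)
import Data.Nat.Properties as ℕ
open import Data.Product.Base using (_×_; _,_; proj₁; ∃-syntax; Σ-syntax)
open import Data.Rational.Base as ℚ using (ℚ; 0ℚ; ½; ↥_; ↧ₙ_; +-*-rawSemiring)
open import Data.Sum.Base using (_⊎_)
open import Relation.Binary.PropositionalEquality.Core using (_≡_; _≢_)
open import Relation.Nullary.Decidable.Core using (Dec; ¬?; _⊎-dec_)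
open import Relation.Nullary.Negation.Core using (¬_)

------------------------------------------------------------------------
-- Real numbers as two-sided cuts: the rationals strictly below and the
-- rationals strictly above.  Only the data of a cut is recorded.  The
-- operations below give the cuts of the usual real functions when their
-- arguments are cuts of positive reals.

record Real : Set₁ where
  field
    lower : ℚ → Set
    upper : ℚ → Set

open Real public

infix  4 _≤ʳ_
infixl 7 _÷ʳ_
infixr 7 ½*_
infixr 8 _^ℚ_

_^ℚ_ : ℚ → ℕ → ℚ
_^ℚ_ = pow +-*-rawSemiring

fromℕ : ℕ → ℚ
fromℕ n = (+ n) ℚ./ 1

2^_ : ℤ → ℚ
2^ (+ n)    = fromℕ 2 ^ℚ n
2^ -[1+ n ] = ½ ^ℚ suc n

fromℚ : ℚ → Real
fromℚ q = record { lower = λ r → r ℚ.< q ; upper = λ r → q ℚ.< r }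

_≤ʳ_ : ℚ → Real → Set
q ≤ʳ x = ¬ upper x q

-- For r = p / q with q > 0, one has 2 ^ r < s iff 2 ^ p < s ^ q (s > 0).
log₂ : Real → Real
log₂ x = record
  { lower = λ r → ∃[ s ] lower x s × 0ℚ ℚ.< s × 2^ (↥ r) ℚ.< s ^ℚ (↧ₙ r)
  ; upper = λ r → ∃[ s ] upper x s × s ^ℚ (↧ₙ r) ℚ.< 2^ (↥ r)
  }

_÷ʳ_ : Real → Real → Real
x ÷ʳ y = record
  { lower = λ r → ∃[ s ] ∃[ t ] lower x s × upper y t × r ℚ.* t ℚ.< s
  ; upper = λ r → ∃[ s ] ∃[ t ] upper x s × lower y t × 0ℚ ℚ.< t × s ℚ.< r ℚ.* t
  }

√_ : Real → Real
√ x = record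
  { lower = λ r → r ℚ.< 0ℚ ⊎ lower x (r ℚ.* r)
  ; upper = λ r → 0ℚ ℚ.< r × upper x (r ℚ.* r)
  }

½*_ : Real → Real
½* x = record
  { lower = λ r → lower x (fromℕ 2 ℚ.* r)
  ; upper = λ r → upper x (fromℕ 2 ℚ.* r)
  }

-- x ^ (a / b), for b > 0
_^[_/_] : Real → ℕ → ℕ → Real
x ^[ a / b ] = record
  { lower = λ r → r ℚ.< 0ℚ ⊎ (∃[ s ] lower x s × 0ℚ ℚ.< s × r ^ℚ b ℚ.< s ^ℚ a)
  ; upper = λ r → 0ℚ ℚ.< r × (∃[ s ] upper x s × s ^ℚ a ℚ.< r ^ℚ b)
  }

------------------------------------------------------------------------
-- The online labeling game

-- A storage function for Y is a total function of which only the values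
-- on Y matter.
record IsStorageFunction (m : ℕ) (Y : List ℤ) (f : ℤ → ℕ) : Set where
  field
    inArray : ∀ {y} → y ∈ Y → 1 ≤ f y × f y ≤ m
    mono    : ∀ {x y} → x ∈ Y → y ∈ Y → x ℤ.< y → f x < f y

-- A deterministic algorithm's own past moves are determined by the keys,
-- so its move is a function of the keys received so far.  Lists of keys
-- are ordered with the most recent key first.
record Algorithm (n m : ℕ) : Set where
  field
    respond : List ℤ → (ℤ → ℕ)
    storage : ∀ ys → Unique ys → length ys ≤ n →
              IsStorageFunction m ys (respond ys)

open Algorithm public

-- The steps (yᵗ , fᵗ) played so far, most recent first.
History : Set
History = List (ℤ × (ℤ → ℕ))

keys : History → List ℤ
keys = map proj₁

record Adversary : Set where
  field
    select : History → ℤ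
    fresh  : ∀ h → select h ∉ keys h

open Adversary public

play : ∀ {n m} → Algorithm n m → Adversary → ℕ → History
play A B zero    = []
play A B (suc t) = (y , respond A (y ∷ keys h)) ∷ h
  where
  h = play A B t
  y = select B h

-- Before the first step no key is stored, so the value there is immaterial.
current : History → (ℤ → ℕ)
current []            = λ _ → 0
current ((_ , f) ∷ _) = f

Relocated : ℤ → (ℤ → ℕ) → History → ℤ → Set
Relocated yᵗ fᵗ h y = y ≡ yᵗ ⊎ fᵗ y ≢ current h y

relocated? : ∀ yᵗ fᵗ h y → Dec (Relocated yᵗ fᵗ h y)
relocated? yᵗ fᵗ h y = (y ℤ.≟ yᵗ) ⊎-dec ¬? (fᵗ y ℕ.≟ current h y)

Rel : ℤ → (ℤ → ℕ) → History → List ℤ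
Rel yᵗ fᵗ h = filter (relocated? yᵗ fᵗ h) (yᵗ ∷ keys h)

totalCost : History → ℕ
totalCost []             = 0
totalCost ((yᵗ , fᵗ) ∷ h) = length (Rel yᵗ fᵗ h) + totalCost h

WorstCase≤ : ∀ {n m} → Algorithm n m → ℕ → Set
WorstCase≤ {n} A c = ∀ (B : Adversary) → totalCost (play A B n) ≤ c

Achievable : (n m c : ℕ) → Set
Achievable n m c = Σ[ A ∈ Algorithm n m ] WorstCase≤ A c

-- χⁿ(m) = c
Isχ : (n m c : ℕ) → Set
Isχ n m c = Achievable n m c × (∀ d → Achievable n m d → c ≤ d)

{-# OPTIONS --safe #-}

-- Choose r = 1 + u with uᵏ ≤ n < rᵏ and store the keys in a hierarchy of k
-- levels, in which a bucket of level j holds between rʲ and 2rʲ keys; a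
-- bucket that reaches 2rʲ keys is split into two halves, which are rebuilt
-- from scratch.  The buckets inside a bucket (or inside the root) are the
-- leaves of a binary tree, in which a split replaces a leaf by a node with
-- two leaves, so that no other key moves.  The cell of a key is its path,
-- read in binary.  A split costs 2rʲ and is preceded by rʲ insertions, hence
-- it is paid for by 2 units per insertion and level below the root; the new
-- key itself pays 1, in total 2 (k - 1) + 1.  A binary tree with fewer than
-- 2r leaves has height at most 2u, so paths have length at most 2uk, and the
-- hypotheses say that 2uk ≤ log₂ m.
module Submission where

open import Defs
import Data.Integer.Properties as ℤ
import Data.List.Membership.DecPropositional as DecMembership
import Data.List.Properties as List
import Data.List.Relation.Unary.All.Properties as All
import Data.List.Relation.Unary.AllPairs.Properties as AllPairs
import Data.List.Relation.Unary.Unique.Propositional.Properties as Unique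
import Data.Nat.Coprimality as Coprime
import Data.Nat.Properties as ℕ
import Data.Rational.Properties as ℚ
open import Data.Bool.Base using (true; false; if_then_else_)
open import Data.Integer.Base as ℤ using (ℤ; +_)
open import Data.List.Base using (List; []; _∷_; _++_; [_]; length; take; drop; replicate)
open import Data.List.Membership.Propositional using (_∈_; _∉_)
open import Data.List.Membership.Propositional.Properties
  using (∈-++⁺ˡ; ∈-++⁺ʳ; ∈-++⁻; ∈-∃++; ∈-filter⁻; ∈-map⁻)
open import Data.List.Relation.Unary.All as All using ([]; _∷_)
open import Data.List.Relation.Unary.AllPairs using (AllPairs; []; _∷_)
open import Data.List.Relation.Unary.Any using (here; there)
open import Data.List.Relation.Unary.Unique.Propositional using (Unique)
open import Data.Maybe.Base using (Maybe; nothing; just)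
open import Data.Maybe.Properties using (just-injective; ≡-dec)
open import Data.Nat.Base
  using (ℕ; zero; suc; pred; _+_; _*_; _∸_; _^_; _⊔_; _≤_; _<_; z≤n; s≤s; z<s; s≤s⁻¹; >-nonZero)
open import Data.Nat.Tactic.RingSolver using (solve-∀)
open import Data.Product.Base using (_×_; _,_; proj₁; proj₂; ∃-syntax)
open import Data.Rational.Base as ℚ using (mkℚ)
open import Data.Sum.Base using (_⊎_; inj₁; inj₂)
open import Function.Base using (_∘_)
open import Relation.Binary.Definitions using (Transitive; tri<; tri≈; tri>)
open import Relation.Binary.PropositionalEquality hiding ([_])
open import Relation.Nullary using (¬_; Dec; yes; no; does; contradiction)
open import Relation.Nullary.Decidable using (map′)

-- Real bounds as inequalities between natural numbers

-- `_/_` normalises by a gcd that is stuck on a variable; the constructor form makes numerator,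
-- denominator and products compute.
fromℕ-mkℚ : ∀ n → fromℕ n ≡ mkℚ (+ n) 0 (Coprime.sym (Coprime.1-coprimeTo n))
fromℕ-mkℚ n = ℚ.↥p/↧p≡p (mkℚ (+ n) 0 (Coprime.sym (Coprime.1-coprimeTo n)))

↥-fromℕ : ∀ n → ℚ.↥ (fromℕ n) ≡ + n
↥-fromℕ n = cong ℚ.↥_ (fromℕ-mkℚ n)

↧-fromℕ : ∀ n → ℚ.↧ₙ (fromℕ n) ≡ 1
↧-fromℕ n = cong ℚ.↧ₙ_ (fromℕ-mkℚ n)

fromℕ-mono-< : ∀ {m n} → m < n → fromℕ m ℚ.< fromℕ n
fromℕ-mono-< {m} {n} m<n = subst₂ ℚ._<_ (sym (fromℕ-mkℚ m)) (sym (fromℕ-mkℚ n))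
  (ℚ.*<* (subst₂ ℤ._<_ (sym (ℤ.*-identityʳ (+ m))) (sym (ℤ.*-identityʳ (+ n))) (ℤ.+<+ m<n)))

fromℕ-homo-* : ∀ m n → fromℕ (m * n) ≡ fromℕ m ℚ.* fromℕ n
fromℕ-homo-* m n = begin
  fromℕ (m * n)              ≡⟨ cong (ℚ._/ 1) (ℤ.pos-* m n) ⟩
  (+ m ℤ.* + n) ℚ./ 1        ≡⟨ cong₂ ℚ._*_ (fromℕ-mkℚ m) (fromℕ-mkℚ n) ⟨
  fromℕ m ℚ.* fromℕ n        ∎
  where open ≡-Reasoning

fromℕ-homo-^ : ∀ m n → fromℕ (m ^ n) ≡ fromℕ m ^ℚ n
fromℕ-homo-^ m zero    = refl
fromℕ-homo-^ m (suc n) = trans (fromℕ-homo-* m (m ^ n)) (cong (fromℕ m ℚ.*_) (fromℕ-homo-^ m n))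

^-fromℕ-mono-< : ∀ m a n b → m ^ a < n ^ b → fromℕ m ^ℚ a ℚ.< fromℕ n ^ℚ b
^-fromℕ-mono-< m a n b p = subst₂ ℚ._<_ (fromℕ-homo-^ m a) (fromℕ-homo-^ n b) (fromℕ-mono-< p)

2^-fromℕ : ∀ n → 2^ (ℚ.↥ fromℕ n) ≡ fromℕ (2 ^ n)
2^-fromℕ n = trans (cong 2^_ (↥-fromℕ n)) (sym (fromℕ-homo-^ 2 n))

^-↧-fromℕ : ∀ s n → fromℕ s ^ℚ (ℚ.↧ₙ (fromℕ n)) ≡ fromℕ s
^-↧-fromℕ s n = trans (cong (fromℕ s ^ℚ_) (↧-fromℕ n)) (ℚ.*-identityʳ (fromℕ s))

-- A natural number has denominator 1, so the power of `s` demanded by `log₂` is `s` itself.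
log₂-upper : ∀ x s e → upper x (fromℕ s) → s < 2 ^ e → upper (log₂ x) (fromℕ e)
log₂-upper x s e x<s s<2^e =
  fromℕ s , x<s ,
  subst₂ ℚ._<_ (sym (^-↧-fromℕ s e)) (sym (2^-fromℕ e)) (fromℕ-mono-< s<2^e)

log₂-lower : ∀ x s e → lower x (fromℕ s) → 2 ^ e < s → lower (log₂ x) (fromℕ e)
log₂-lower x s e s<x 2^e<s =
  fromℕ s , s<x , fromℕ-mono-< (ℕ.≤-<-trans z≤n 2^e<s) ,
  subst₂ ℚ._<_ (sym (2^-fromℕ e)) (sym (^-↧-fromℕ s e)) (fromℕ-mono-< 2^e<s)

-- Walking down from `b`, the first value not above `N` gives the crossing. This supplies the
-- integer logarithm of `m` and the integer `k`-th root of `n`.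
first-exceeding : ∀ (f : ℕ → ℕ) N b → f 0 ≤ N → N < f b → ∃[ i ] f i ≤ N × N < f (suc i)
first-exceeding f N zero    f0≤N N<f0 = contradiction f0≤N (ℕ.<⇒≱ N<f0)
first-exceeding f N (suc b) f0≤N N<fb with f b ℕ.≤? N
... | yes fb≤N = b , fb≤N , N<fb
... | no  fb≰N = first-exceeding f N b f0≤N (ℕ.≰⇒> fb≰N)

*-self-cancel-≤ : ∀ {a b} → a * a ≤ b * b → a ≤ b
*-self-cancel-≤ aa≤bb = ℕ.≮⇒≥ λ b<a → ℕ.<⇒≱ (ℕ.*-mono-< b<a b<a) aa≤bb

n<2^n : ∀ n → n < 2 ^ n
n<2^n zero    = z<s
n<2^n (suc n) = ℕ.+-mono-≤ (ℕ.m^n>0 2 n) (ℕ.≤-trans (n<2^n n) (ℕ.m≤m+n (2 ^ n) 0))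

module _ {m k : ℕ} (2^16<m : 2 ^ 16 < m) (1≤k : 1 ≤ k) where

  M : Real
  M = fromℚ (fromℕ m)

  -- The bound log₂ log₂ m > 2 is all that is used of the divisor.
  8k²≤log :
    fromℕ k ≤ʳ ½* √ (log₂ M ÷ʳ log₂ (log₂ M)) →
    ∀ {e} → suc m < 2 ^ e → (2 * k) * (2 * k) * 2 ≤ e
  8k²≤log k≤ {e} m<2^e = ℕ.≮⇒≥ λ e<8k² → k≤
    ( subst (ℚ.0ℚ ℚ.<_) (fromℕ-homo-* 2 k) (fromℕ-mono-< (ℕ.*-mono-< (z<s {1}) 1≤k))
    , fromℕ e , fromℕ 2
    -- The upper cut of `m` is strict, so the least natural number in it is `suc m`.
    , log₂-upper M (suc m) e (fromℕ-mono-< (ℕ.n<1+n m)) m<2^e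
    -- `log₂ m > 5` since `2 ^ 5 < 33 < m`, and then `log₂ log₂ m > 2` since `2 ^ 2 < 5`.
    , log₂-lower (log₂ M) 5 2 (log₂-lower M 33 5 (fromℕ-mono-< 33<m) (ℕ.n<1+n 32)) (ℕ.n<1+n 4)
    , fromℕ-mono-< (z<s {1})
    , subst (fromℕ e ℚ.<_) product (fromℕ-mono-< e<8k²))
    where
    33<m : 33 < m
    33<m = ℕ.≤-<-trans (ℕ.m≤m+n 33 31) (ℕ.≤-<-trans (ℕ.^-monoʳ-≤ 2 (ℕ.m≤m+n 6 10)) 2^16<m)
    product : fromℕ ((2 * k) * (2 * k) * 2) ≡
              (fromℕ 2 ℚ.* fromℕ k) ℚ.* (fromℕ 2 ℚ.* fromℕ k) ℚ.* fromℕ 2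
    product = trans (fromℕ-homo-* ((2 * k) * (2 * k)) 2) (cong (ℚ._* fromℕ 2)
      (trans (fromℕ-homo-* (2 * k) (2 * k)) (cong₂ ℚ._*_ (fromℕ-homo-* 2 k) (fromℕ-homo-* 2 k))))

  -- If `e ^ k < n ^ 3`, then `e`, which lies strictly above `log₂ m`, would witness that `n` is
  -- strictly above the `k / 3` power.
  n³≤logᵏ : ∀ {n} → 1 ≤ n → fromℕ n ≤ʳ log₂ M ^[ k / 3 ] →
            ∀ {e} → suc m < 2 ^ e → n ^ 3 ≤ e ^ k
  n³≤logᵏ {n} 1≤n n≤ {e} m<2^e = ℕ.≮⇒≥ λ eᵏ<n³ → n≤
    ( fromℕ-mono-< 1≤n
    , fromℕ e
    , log₂-upper M (suc m) e (fromℕ-mono-< (ℕ.n<1+n m)) m<2^e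
    , ^-fromℕ-mono-< e k n 3 eᵏ<n³)

  -- Cubing `u ^ k ≤ n` and cancelling the exponent `k` gives `u ^ 3 ≤ 2 + e`, hence
  -- `u * u ≤ 2 + e`. Multiplied by the bound on `8 * k ^ 2`, this bounds twice the square of
  -- `2 * u * k` by `(2 + e) ^ 2`; the factor 2 absorbs the rounding from `2 + e` to `e` once `e` is
  -- at least 16.
  2uk≤log : ∀ {n u e} → 16 ≤ e → (2 * k) * (2 * k) * 2 ≤ 2 + e →
            n ^ 3 ≤ (2 + e) ^ k → u ^ k ≤ n → 2 * u * k ≤ e
  2uk≤log {n} {u} {e} 16≤e 8k²≤ n³≤ uᵏ≤n = *-self-cancel-≤ (ℕ.*-cancelˡ-≤ 2 (begin
    2 * ((2 * u * k) * (2 * u * k))        ≡⟨ rearrange u k ⟩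
    (u * u) * ((2 * k) * (2 * k) * 2)      ≤⟨ ℕ.*-mono-≤ u²≤ 8k²≤ ⟩
    (2 + e) * (2 + e)                      ≤⟨ square≤ ⟩
    2 * (e * e)                            ∎))
    where
    open ℕ.≤-Reasoning
    rearrange : ∀ u k → 2 * ((2 * u * k) * (2 * u * k)) ≡ (u * u) * ((2 * k) * (2 * k) * 2)
    rearrange = solve-∀
    uᵏ³≤ : (u ^ 3) ^ k ≤ (2 + e) ^ k
    uᵏ³≤ = begin
      (u ^ 3) ^ k   ≡⟨ ℕ.^-*-assoc u 3 k ⟩
      u ^ (3 * k)   ≡⟨ cong (u ^_) (ℕ.*-comm 3 k) ⟩
      u ^ (k * 3)   ≡⟨ ℕ.^-*-assoc u k 3 ⟨
      (u ^ k) ^ 3   ≤⟨ ℕ.^-monoˡ-≤ 3 uᵏ≤n ⟩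
      n ^ 3         ≤⟨ n³≤ ⟩
      (2 + e) ^ k   ∎
    u³≤ : u ^ 3 ≤ 2 + e
    u³≤ = ℕ.≮⇒≥ λ lt → ℕ.<⇒≱ (ℕ.^-monoˡ-< k {{>-nonZero 1≤k}} lt) uᵏ³≤
    u²≤u³ : ∀ u → u * u ≤ u ^ 3
    u²≤u³ zero      = z≤n
    u²≤u³ u@(suc _) = subst (_≤ u ^ 3) (cong (u *_) (ℕ.*-identityʳ u)) (ℕ.^-monoʳ-≤ u (ℕ.n≤1+n 2))
    u²≤ : u * u ≤ 2 + e
    u²≤ = ℕ.≤-trans (u²≤u³ u) u³≤
    square≤ : (2 + e) * (2 + e) ≤ 2 * (e * e)
    square≤ = begin
      (2 + e) * (2 + e)      ≡⟨ expand e ⟩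
      e * e + (4 * e + 4)    ≤⟨ ℕ.+-monoʳ-≤ (e * e) (ℕ.+-monoʳ-≤ (4 * e) (ℕ.≤-trans (ℕ.m≤m+n 4 12) 16≤e)) ⟩
      e * e + (4 * e + e)    ≡⟨ cong (λ x → e * e + x) (ℕ.+-comm (4 * e) e) ⟩
      e * e + 5 * e          ≤⟨ ℕ.+-monoʳ-≤ (e * e) (ℕ.*-monoˡ-≤ e (ℕ.≤-trans (ℕ.m≤m+n 5 11) 16≤e)) ⟩
      e * e + e * e          ≡⟨ cong (λ x → e * e + x) (ℕ.+-identityʳ (e * e)) ⟨
      2 * (e * e)            ∎
      where
      expand : ∀ e → (2 + e) * (2 + e) ≡ e * e + (4 * e + 4)
      expand = solve-∀

  parameters : ∀ {n} →
    fromℕ k ≤ʳ ½* √ (log₂ M ÷ʳ log₂ (log₂ M)) →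
    1 ≤ n →
    fromℕ n ≤ʳ log₂ M ^[ k / 3 ] →
    ∃[ u ] n < suc u ^ k × 2 ^ (2 * u * k) ≤ m
  parameters {n} k≤ 1≤n n≤
    with first-exceeding (2 ^_) m m (ℕ.≤-trans (ℕ.m^n>0 2 16) (ℕ.<⇒≤ 2^16<m)) (n<2^n m)
  ... | e , 2^e≤m , m<2^1+e
    -- `u` is the integer part of the `k`-th root of `n`; the search runs between `0 ^ k = 0` and
    -- `suc n ^ k > n`.
    with first-exceeding (_^ k) n (suc n) (ℕ.≤-trans (ℕ.≤-reflexive (0^k 1≤k)) z≤n)
           (subst (_≤ suc n ^ k) (ℕ.*-identityʳ (suc n)) (ℕ.^-monoʳ-≤ (suc n) 1≤k))
    where
    0^k : ∀ {k} → 1 ≤ k → 0 ^ k ≡ 0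
    0^k (s≤s _) = refl
  ... | u , uᵏ≤n , n<rᵏ = u , n<rᵏ , ℕ.≤-trans (ℕ.^-monoʳ-≤ 2 2uk≤e) 2^e≤m
    where
    -- `m < 2 ^ (1 + e)` still allows `suc m = 2 ^ (1 + e)`, hence one more doubling.
    1+m<2^2+e : suc m < 2 ^ (2 + e)
    1+m<2^2+e = ℕ.≤-<-trans m<2^1+e (ℕ.^-monoʳ-< 2 (ℕ.n<1+n 1) (ℕ.n<1+n (suc e)))
    16≤e : 16 ≤ e
    16≤e = ℕ.≮⇒≥ λ e<16 → ℕ.<⇒≱ (ℕ.<-trans 2^16<m m<2^1+e) (ℕ.^-monoʳ-≤ 2 e<16)
    2uk≤e : 2 * u * k ≤ e
    2uk≤e = 2uk≤log {n} {u} 16≤e (8k²≤log k≤ 1+m<2^2+e) (n³≤logᵏ 1≤n n≤ 1+m<2^2+e) uᵏ≤n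

-- The data structure

open DecMembership (≡-dec ℤ._≟_) using (_∈?_)

-- Pigeonhole: each entry of `xs` strikes its own occurrence out of `ys`. It turns "every relocated
-- key lies in this list" into a bound on the cost.
Unique-⊆⇒length≤ : ∀ {A : Set} {xs ys : List A} → Unique xs →
                   (∀ {x} → x ∈ xs → x ∈ ys) → length xs ≤ length ys
Unique-⊆⇒length≤ {xs = []} _ _ = z≤n
Unique-⊆⇒length≤ {xs = x ∷ xs} (x∉xs ∷ xs!) xs⊆ys with ∈-∃++ (xs⊆ys (here refl))
... | as , bs , refl = begin
  suc (length xs)         ≤⟨ s≤s (Unique-⊆⇒length≤ xs! xs⊆) ⟩
  suc (length (as ++ bs)) ≡⟨ List.length-++-sucʳ as x bs ⟨
  length (as ++ x ∷ bs)   ∎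
  where
  open ℕ.≤-Reasoning
  xs⊆ : ∀ {z} → z ∈ xs → z ∈ as ++ bs
  xs⊆ z∈xs with ∈-++⁻ as (xs⊆ys (there z∈xs))
  ... | inj₁ z∈as          = ∈-++⁺ˡ z∈as
  ... | inj₂ (here refl)   = contradiction refl (All.lookup x∉xs z∈xs)
  ... | inj₂ (there z∈bs)  = ∈-++⁺ʳ as z∈bs

-- Keys with sentinels and sorted lists

-- Besides the real keys, a tree contains sentinels "nothing", which precede
-- everything, each other included.  Starting with rᵏ of them, every bucket has
-- its rʲ elements from the outset, and no key is smaller than the whole tree.
Key : Set
Key = Maybe ℤ

infix 4 _≺_ _≺?_

data _≺_ : Key → Key → Set where
  -∞≺  : ∀ {y} → nothing ≺ y
  just : ∀ {x y} → x ℤ.< y → just x ≺ just y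

≺-trans : Transitive _≺_
≺-trans -∞≺      _        = -∞≺
≺-trans (just p) (just q) = just (ℤ.<-trans p q)

_≺?_ : ∀ x y → Dec (x ≺ y)
nothing ≺? _       = yes -∞≺
just x  ≺? nothing = no λ ()
just x  ≺? just y  = map′ just (λ { (just p) → p }) (x ℤ.<? y)

-- One side has to be a real key, because two sentinels precede each other.
≺-asym : ∀ {x y} → just x ≺ y → ¬ (y ≺ just x)
≺-asym (just p) (just q) = ℤ.<-asym p q

⊀⇒≺ : ∀ {x y} → just x ≢ y → ¬ (just x ≺ y) → y ≺ just x
⊀⇒≺ {y = nothing}    x≢y x⊀y = -∞≺
⊀⇒≺ {x} {y = just y} x≢y x⊀y with ℤ.<-cmp x y
... | tri< x<y _ _ = contradiction (just x<y) x⊀y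
... | tri≈ _ x≡y _ = contradiction (cong just x≡y) x≢y
... | tri> _ _ y<x = just y<x

Sorted : List Key → Set
Sorted = AllPairs _≺_

Sorted-++⁺ : ∀ {xs ys} → Sorted xs → Sorted ys →
             (∀ {x y} → x ∈ xs → y ∈ ys → x ≺ y) → Sorted (xs ++ ys)
Sorted-++⁺ xs↗ ys↗ xs≺ys = AllPairs.++⁺ xs↗ ys↗ (All.tabulate λ x∈ → All.tabulate λ y∈ → xs≺ys x∈ y∈)

Sorted-++⁻ : ∀ xs {ys} → Sorted (xs ++ ys) →
             Sorted xs × Sorted ys × (∀ {x y} → x ∈ xs → y ∈ ys → x ≺ y)
Sorted-++⁻ []       ys↗         = [] , ys↗ , λ ()
Sorted-++⁻ (x ∷ xs) (x≺ ∷ xys↗) with Sorted-++⁻ xs xys↗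
... | xs↗ , ys↗ , xs≺ys = (All.++⁻ˡ xs x≺ ∷ xs↗) , ys↗ ,
  λ { (here refl) y∈ → All.lookup (All.++⁻ʳ xs x≺) y∈ ; (there x∈) y∈ → xs≺ys x∈ y∈ }

Sorted-replicate : ∀ n → Sorted (replicate n nothing)
Sorted-replicate zero    = []
Sorted-replicate (suc n) = All.replicate⁺ n -∞≺ ∷ Sorted-replicate n

-- Trees and the cells they assign

data Tree : ℕ → Set where
  key    : Key → Tree 0
  bucket : ∀ {j} → Tree j → Tree (suc j)
  node   : ∀ {j} → Tree (suc j) → Tree (suc j) → Tree (suc j)

contents : ∀ {j} → Tree j → List Key
contents (key x)    = [ x ]
contents (bucket t) = contents t
contents (node l r) = contents l ++ contents r

size : ∀ {j} → Tree j → ℕ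
size t = length (contents t)

min : ∀ {j} → Tree j → Key
min (key x)    = x
min (bucket t) = min t
min (node l r) = min l

-- A `bucket` only marks where a level ends; the bits of a cell number are consumed by the nodes
-- alone.
height : ∀ {j} → Tree j → ℕ
height (key x)    = 0
height (bucket t) = height t
height (node l r) = suc (height l ⊔ height r)

contents-min : ∀ {j} (t : Tree j) → ∃[ xs ] contents t ≡ min t ∷ xs
contents-min (key x)    = [] , refl
contents-min (bucket t) = contents-min t
contents-min (node l r) with contents-min l
... | xs , eq = xs ++ contents r , cong (_++ contents r) eq

min∈ : ∀ {j} (t : Tree j) → min t ∈ contents t
min∈ t with contents-min t
... | _ , eq = subst (min t ∈_) (sym eq) (here refl)

min-least : ∀ {j} (t : Tree j) → Sorted (contents t) → ∀ {x} → x ∈ contents t → x ≡ min t ⊎ min t ≺ x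
min-least t t↗ x∈ with contents-min t
... | xs , eq with subst Sorted eq t↗ | subst (_ ∈_) eq x∈
... | m≺ ∷ _ | here x≡m  = inj₁ x≡m
... | m≺ ∷ _ | there x∈′ = inj₂ (All.lookup m≺ x∈′)

-- Links the comparison made by a search to membership: sortedness puts all of `l` before `min r`,
-- while no real key of `r` precedes `min r`.
locate : ∀ {j} (l r : Tree (suc j)) → Sorted (contents l ++ contents r) →
         ∀ {x} → just x ∈ contents l ++ contents r →
         just x ≺ min r × just x ∈ contents l ⊎ ¬ (just x ≺ min r) × just x ∈ contents r
locate l r lr↗ x∈ with Sorted-++⁻ (contents l) lr↗ | ∈-++⁻ (contents l) x∈
... | _ , _ , l≺r  | inj₁ x∈l = inj₁ (l≺r x∈l (min∈ r) , x∈l)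
... | _ , r↗ , _   | inj₂ x∈r = inj₂ ((λ x≺m → x⊀m x≺m (min-least r r↗ x∈r)) , x∈r)
  where
  x⊀m : ∀ {x m} → just x ≺ m → ¬ (just x ≡ m ⊎ m ≺ just x)
  x⊀m p         (inj₂ q)    = ≺-asym p q
  x⊀m p         (inj₁ refl) = ≺-asym p p

-- The cells o, …, o + 2 ^ h - 1 are halved at every node.
label : ∀ {j} → (h o : ℕ) → Tree j → ℤ → ℕ
label h o (key _)    x = o
label h o (bucket t) x = label h o t x
label h o (node l r) x =
  if does (just x ≺? min r) then label (pred h) o l x else label (pred h) (o + 2 ^ pred h) r x

2^suc : ∀ o h → o + 2 ^ h + 2 ^ h ≡ o + 2 ^ suc h
2^suc o h = trans (ℕ.+-assoc o (2 ^ h) (2 ^ h)) (cong (λ z → o + (2 ^ h + z)) (sym (ℕ.+-identityʳ (2 ^ h))))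

-- The bound on the height makes `h` positive at every node, so `pred h` is a true predecessor and
-- the subtrees receive the two halves of the interval.
label-bounds : ∀ {j} h o (t : Tree j) → height t ≤ h → ∀ x → o ≤ label h o t x × label h o t x < o + 2 ^ h
label-bounds h o (key _) _ x = ℕ.≤-refl , ℕ.m<m+n o (ℕ.m^n>0 2 h)
label-bounds h o (bucket t) t≤h x = label-bounds h o t t≤h x
label-bounds (suc h) o (node l r) (s≤s lr≤h) x with does (just x ≺? min r)
... | true  with label-bounds h o l (ℕ.≤-trans (ℕ.m≤m⊔n _ _) lr≤h) x
...   | lo , hi = lo , ℕ.<-≤-trans hi (ℕ.+-monoʳ-≤ o (ℕ.^-monoʳ-≤ 2 (ℕ.n≤1+n h)))
label-bounds (suc h) o (node l r) (s≤s lr≤h) x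
    | false with label-bounds h (o + 2 ^ h) r (ℕ.≤-trans (ℕ.m≤n⊔m (height l) _) lr≤h) x
...   | lo , hi = ℕ.≤-trans (ℕ.m≤m+n o _) lo , subst (label h (o + 2 ^ h) r x <_) (2^suc o h) hi

label-mono : ∀ {j} h o (t : Tree j) → height t ≤ h → Sorted (contents t) →
             ∀ {x y} → just x ∈ contents t → just y ∈ contents t → x ℤ.< y →
             label h o t x < label h o t y
label-mono h o (key _) _ _ (here refl) (here refl) x<y = contradiction x<y (ℤ.<-irrefl refl)
label-mono h o (bucket t) t≤h t↗ x∈ y∈ x<y = label-mono h o t t≤h t↗ x∈ y∈ x<y
label-mono (suc h) o (node l r) (s≤s lr≤h) t↗ {x} {y} x∈ y∈ x<y
  with Sorted-++⁻ (contents l) t↗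
... | l↗ , r↗ , l≺r
  with just x ≺? min r | locate l r t↗ x∈ | just y ≺? min r | locate l r t↗ y∈
... | yes _   | inj₁ (_ , x∈l)   | yes _   | inj₁ (_ , y∈l) =
  label-mono h o l (ℕ.≤-trans (ℕ.m≤m⊔n _ _) lr≤h) l↗ x∈l y∈l x<y
-- Here `x` goes left and `y` goes right, and the midpoint `o + 2 ^ h` separates their cells.
... | yes _   | _                | no _    | _              =
  ℕ.<-≤-trans (proj₂ (label-bounds h o l (ℕ.≤-trans (ℕ.m≤m⊔n _ _) lr≤h) x))
              (proj₁ (label-bounds h (o + 2 ^ h) r (ℕ.≤-trans (ℕ.m≤n⊔m (height l) _) lr≤h) y))
... | no x⊀m  | _                | yes y≺m | _              = contradiction (≺-trans (just x<y) y≺m) x⊀m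
... | no _    | inj₂ (_ , x∈r)   | no _    | inj₂ (_ , y∈r) =
  label-mono h (o + 2 ^ h) r (ℕ.≤-trans (ℕ.m≤n⊔m (height l) _) lr≤h) r↗ x∈r y∈r x<y
-- In the remaining cases the comparison contradicts the side reported by `locate`.
... | yes x≺m | inj₂ (x⊀m , _)   | _       | _              = contradiction x≺m x⊀m
... | no x⊀m  | inj₁ (x≺m , _)   | _       | _              = contradiction x≺m x⊀m
... | _       | _                | yes y≺m | inj₂ (y⊀m , _) = contradiction y≺m y⊀m
... | _       | _                | no y⊀m  | inj₁ (y≺m , _) = contradiction y≺m y⊀m

-- Fresh trees and the size invariant

length-take-+ : ∀ w v (xs : List Key) → length xs ≡ w + v → length (take w xs) ≡ w
length-take-+ w v xs eq =
  trans (List.length-take w xs) (ℕ.m≤n⇒m⊓n≡m (subst (w ≤_) (sym eq) (ℕ.m≤m+n w v)))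

length-drop-+ : ∀ w v (xs : List Key) → length xs ≡ w + v → length (drop w xs) ≡ v
length-drop-+ w v xs eq = trans (List.length-drop w xs) (trans (cong (_∸ w) eq) (ℕ.m+n∸m≡n w v))

module Loading (u : ℕ) where

  weight : ℕ → ℕ
  weight j = suc u ^ j

  -- A comb of `suc c` buckets is good enough, since heights are later bounded through the number of
  -- leaves alone.
  comb : ∀ {j} → (List Key → Tree j) → ℕ → ℕ → List Key → Tree (suc j)
  comb f w zero    xs = bucket (f xs)
  comb f w (suc c) xs = node (bucket (f (take w xs))) (comb f w c (drop w xs))

  -- On the empty list, which does not occur, the result is arbitrary.
  build : ∀ j → List Key → Tree j
  build zero    []      = key nothing
  build zero    (x ∷ _) = key x
  build (suc j) xs      = comb (build j) (weight j) u xs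

  contents-build : ∀ j xs → length xs ≡ weight j → contents (build j xs) ≡ xs
  contents-comb : ∀ j c xs → length xs ≡ suc c * weight j →
                  contents (comb (build j) (weight j) c xs) ≡ xs
  contents-build zero    (x ∷ []) eq = refl
  contents-build (suc j) xs       eq = contents-comb j u xs eq
  contents-comb j zero    xs eq = contents-build j xs (trans eq (ℕ.+-identityʳ (weight j)))
  contents-comb j (suc c) xs eq =
    trans (cong₂ _++_ (contents-build j (take (weight j) xs) (length-take-+ (weight j) (suc c * weight j) xs eq))
                      (contents-comb j c (drop (weight j) xs) (length-drop-+ (weight j) (suc c * weight j) xs eq)))
          (List.take++drop≡id (weight j) xs)

  size-build : ∀ j xs → length xs ≡ weight j → size (build j xs) ≡ weight j
  size-build j xs eq = trans (cong length (contents-build j xs eq)) eq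

  -- The window from `weight j` to twice that constrains buckets only; the root is not a bucket, and
  -- its size is bounded separately in `height≤`.
  data Good : ∀ {j} → Tree j → Set where
    key    : ∀ {x} → Good (key x)
    bucket : ∀ {j} {t : Tree j} → weight j ≤ size t → size t < weight j + weight j →
             Good t → Good (bucket t)
    node   : ∀ {j} {l r : Tree (suc j)} → Good l → Good r → Good (node l r)

  weight>0 : ∀ j → 0 < weight j
  weight>0 j = ℕ.m^n>0 (suc u) j

  full-bucket : ∀ {j} (t : Tree j) → size t ≡ weight j → Good t → Good (bucket t)
  full-bucket {j} t eq = bucket (ℕ.≤-reflexive (sym eq))
    (subst (_< weight j + weight j) (sym eq) (ℕ.m<m+n (weight j) (weight>0 j)))

  Good-build : ∀ j xs → length xs ≡ weight j → Good (build j xs)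
  Good-comb : ∀ j c xs → length xs ≡ suc c * weight j → Good (comb (build j) (weight j) c xs)
  Good-bucket : ∀ j xs → length xs ≡ weight j → Good (bucket (build j xs))
  Good-build zero    (x ∷ []) eq = key
  Good-build (suc j) xs       eq = Good-comb j u xs eq
  Good-comb j zero    xs eq = Good-bucket j xs (trans eq (ℕ.+-identityʳ (weight j)))
  Good-comb j (suc c) xs eq =
    node (Good-bucket j _ (length-take-+ (weight j) (suc c * weight j) xs eq))
         (Good-comb j c _ (length-drop-+ (weight j) (suc c * weight j) xs eq))
  Good-bucket j xs eq = full-bucket (build j xs) (size-build j xs eq) (Good-build j xs eq)

  -- Height bound

  leaves : ∀ {j} → Tree (suc j) → ℕ
  leaves (bucket _) = 1
  leaves (node l r) = leaves l + leaves r

  leaves>0 : ∀ {j} (t : Tree (suc j)) → 0 < leaves t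
  leaves>0 (bucket _) = z<s
  leaves>0 (node l r) = ℕ.≤-trans (leaves>0 l) (ℕ.m≤m+n _ _)

  leaves≤size : ∀ {j} {t : Tree (suc j)} → Good t → leaves t * weight j ≤ size t
  leaves≤size {j} (bucket w≤t _ _) = subst (_≤ _) (sym (ℕ.+-identityʳ (weight j))) w≤t
  leaves≤size {j} {node l r} (node gl gr) = begin
    (leaves l + leaves r) * weight j             ≡⟨ ℕ.*-distribʳ-+ (weight j) (leaves l) (leaves r) ⟩
    leaves l * weight j + leaves r * weight j    ≤⟨ ℕ.+-mono-≤ (leaves≤size gl) (leaves≤size gr) ⟩
    size l + size r                              ≡⟨ List.length-++ (contents l) ⟨
    size (node l r)                              ∎
    where open ℕ.≤-Reasoning

  -- Induction on levels: leaves of at least `weight j` elements each, fewer than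
  -- `2 * suc u * weight j` in all, number at most `2 * u + 1`. The nodes of this level thus add at
  -- most `2 * u` to the bound for the levels below.
  height≤ : ∀ {j} {t : Tree j} → Good t → size t < weight j + weight j → height t ≤ 2 * u * j
  -- At a node the sibling of the higher subtree contributes at least one further leaf.
  height<leaves : ∀ {j} {t : Tree (suc j)} → Good t → height t < leaves t + 2 * u * j
  height≤ key _ = z≤n
  height≤ {suc j} {t} g t<2w = begin
    height t                   ≤⟨ s≤s⁻¹ (ℕ.≤-trans (height<leaves g) (ℕ.+-monoˡ-≤ (2 * u * j) leaves≤)) ⟩
    2 * u + 2 * u * j          ≡⟨ ℕ.*-suc (2 * u) j ⟨
    2 * u * suc j              ∎
    where
    open ℕ.≤-Reasoning
    double : ∀ u w → suc u * w + suc u * w ≡ (2 + 2 * u) * w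
    double = solve-∀
    leaves≤ : leaves t ≤ suc (2 * u)
    leaves≤ = s≤s⁻¹ (ℕ.*-cancelʳ-< (weight j) (leaves t) (2 + 2 * u)
      (ℕ.≤-<-trans (leaves≤size g) (subst (size t <_) (double u (weight j)) t<2w)))
  height<leaves (bucket _ t<2w g) = s≤s (height≤ g t<2w)
  height<leaves {j} {node l r} (node gl gr) = ℕ.⊔-lub
    (subst (suc (suc (height l)) ≤_) (swap (leaves l) (leaves r) c)
           (ℕ.+-mono-≤ (leaves>0 r) (height<leaves gl)))
    (subst (suc (suc (height r)) ≤_) (sym (ℕ.+-assoc (leaves l) (leaves r) c))
           (ℕ.+-mono-≤ (leaves>0 l) (height<leaves gr)))
    where
    c = 2 * u * j
    swap : ∀ a b c → b + (a + c) ≡ (a + b) + c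
    swap = solve-∀

  -- Two units for each element that a bucket has gained since it was built with exactly `weight j`.
  -- In a `Good` tree the buckets of level 0 hold a single element and save nothing.
  potential : ∀ {j} → Tree j → ℕ
  potential (key _)        = 0
  potential (bucket {j} t) = 2 * (size t ∸ weight j) + potential t
  potential (node l r)     = potential l + potential r

  potential-build : ∀ j xs → length xs ≡ weight j → potential (build j xs) ≡ 0
  potential-comb : ∀ j c xs → length xs ≡ suc c * weight j →
                   potential (comb (build j) (weight j) c xs) ≡ 0
  potential-bucket : ∀ j xs → length xs ≡ weight j → potential (bucket (build j xs)) ≡ 0
  potential-build zero    (x ∷ []) eq = refl
  potential-build (suc j) xs       eq = potential-comb j u xs eq
  potential-comb j zero    xs eq = potential-bucket j xs (trans eq (ℕ.+-identityʳ (weight j)))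
  potential-comb j (suc c) xs eq =
    cong₂ _+_ (potential-bucket j _ (length-take-+ (weight j) (suc c * weight j) xs eq))
              (potential-comb j c _ (length-drop-+ (weight j) (suc c * weight j) xs eq))
  potential-bucket j xs eq = cong₂ _+_
    (cong (2 *_) (trans (cong (_∸ weight j) (size-build j xs eq)) (ℕ.n∸n≡0 (weight j))))
    (potential-build j xs eq)

  -- Insertion of a key

  -- The list contains every key whose cell may change.
  data Insert (y : ℤ) : ∀ {j} → Tree (suc j) → Tree (suc j) → List Key → Set where
    -- The new leaf goes to the right, as `y` will always exceed the minimum of the tree it enters;
    -- the old key keeps its cell.
    new : ∀ {x} → Insert y (bucket (key x)) (node (bucket (key x)) (bucket (key (just y)))) [ just y ]
    keep  : ∀ {j} {t t′ : Tree (suc j)} {D} → Insert y t t′ D →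
            size t′ ≢ weight (suc j) + weight (suc j) → Insert y (bucket t) (bucket t′) D
    split : ∀ {j} {t t′ : Tree (suc j)} {D} → Insert y t t′ D →
            size t′ ≡ weight (suc j) + weight (suc j) →
            Insert y (bucket t)
              (node (bucket (build (suc j) (take (weight (suc j)) (contents t′))))
                    (bucket (build (suc j) (drop (weight (suc j)) (contents t′)))))
              (contents t′)
    left  : ∀ {j} {l l′ r : Tree (suc j)} {D} → just y ≺ min r → Insert y l l′ D →
            Insert y (node l r) (node l′ r) D
    right : ∀ {j} {l r r′ : Tree (suc j)} {D} → ¬ (just y ≺ min r) → Insert y r r′ D →
            Insert y (node l r) (node l r′) D

  -- Only the decisions are made here; the properties of an insertion are proved by induction on its
  -- derivation.
  insert : ∀ {j} y (t : Tree (suc j)) → ∃[ t′ ] ∃[ D ] Insert y t t′ D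
  insert y (bucket (key x)) = _ , _ , new
  insert {suc j} y (bucket t) with insert y t
  ... | t′ , _ , ins with size t′ ℕ.≟ weight (suc j) + weight (suc j)
  ...   | yes full = _ , _ , split ins full
  ...   | no ¬full = _ , _ , keep ins ¬full
  insert y (node l r) with just y ≺? min r
  ... | yes y≺r = let _ , _ , ins = insert y l in _ , _ , left y≺r ins
  ... | no  y⊀r = let _ , _ , ins = insert y r in _ , _ , right y⊀r ins

  contents-split : ∀ {j} (t : Tree (suc j)) → size t ≡ weight (suc j) + weight (suc j) →
    contents (build (suc j) (take (weight (suc j)) (contents t))) ++
    contents (build (suc j) (drop (weight (suc j)) (contents t))) ≡ contents t
  contents-split {j} t full = trans
    (cong₂ _++_ (contents-build (suc j) _ (length-take-+ w w (contents t) full))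
                (contents-build (suc j) _ (length-drop-+ w w (contents t) full)))
    (List.take++drop≡id w (contents t))
    where w = weight (suc j)

  -- The explicit head `x` records that `y` never becomes the first element. Size, minimum and
  -- membership after an insertion are all read off this form.
  contents-insert : ∀ {y j} {t t′ : Tree (suc j)} {D} → Insert y t t′ D →
    ∃[ x ] ∃[ before ] ∃[ after ]
      contents t ≡ x ∷ before ++ after × contents t′ ≡ x ∷ before ++ just y ∷ after
  contents-insert new = _ , [] , [] , refl , refl
  contents-insert (keep ins _) = contents-insert ins
  contents-insert (split {t′ = t′} ins full) with contents-insert ins
  ... | x , as , bs , eq , eq′ = x , as , bs , eq , trans (contents-split t′ full) eq′
  contents-insert {y} (left {r = r} _ ins) with contents-insert ins
  ... | x , as , bs , eq , eq′ = x , as , bs ++ contents r ,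
    trans (cong (_++ contents r) eq) (cong (x ∷_) (List.++-assoc as bs (contents r))) ,
    trans (cong (_++ contents r) eq′) (cong (x ∷_) (List.++-assoc as (just y ∷ bs) (contents r)))
  contents-insert {y} (right {l = l} _ ins) with contents-insert ins | contents-min l
  ... | x , as , bs , eq , eq′ | ls , eql = min l , ls ++ x ∷ as , bs ,
    trans (cong₂ _++_ eql eq) (cong (min l ∷_) (sym (List.++-assoc ls (x ∷ as) bs))) ,
    trans (cong₂ _++_ eql eq′) (cong (min l ∷_) (sym (List.++-assoc ls (x ∷ as) (just y ∷ bs))))

  module _ {y j} {t t′ : Tree (suc j)} {D} (ins : Insert y t t′ D) where

    size-insert : size t′ ≡ suc (size t)
    size-insert with contents-insert ins
    ... | x , as , bs , eq , eq′ = trans (cong length eq′)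
      (cong suc (trans (List.length-++-sucʳ as (just y) bs) (cong length (sym eq))))

    min-insert : min t′ ≡ min t
    min-insert with contents-insert ins | contents-min t | contents-min t′
    ... | x , as , bs , eq , eq′ | _ , p | _ , p′ =
      trans (List.∷-injectiveˡ (trans (sym p′) eq′)) (List.∷-injectiveˡ (trans (sym eq) p))

    ∈-insert⁺ : ∀ {x} → x ≡ just y ⊎ x ∈ contents t → x ∈ contents t′
    ∈-insert⁺ {x} p with contents-insert ins
    ... | z , as , bs , eq , eq′ = subst (x ∈_) (sym eq′) (go p)
      where
      go : x ≡ just y ⊎ x ∈ contents t → x ∈ z ∷ as ++ just y ∷ bs
      go (inj₁ refl) = ∈-++⁺ʳ (z ∷ as) (here refl)
      go (inj₂ x∈t) with ∈-++⁻ (z ∷ as) (subst (x ∈_) eq x∈t)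
      ... | inj₁ x∈as = ∈-++⁺ˡ x∈as
      ... | inj₂ x∈bs = ∈-++⁺ʳ (z ∷ as) (there x∈bs)

    ∈-insert⁻ : ∀ {x} → x ∈ contents t′ → x ≡ just y ⊎ x ∈ contents t
    ∈-insert⁻ {x} x∈t′ with contents-insert ins
    ... | z , as , bs , eq , eq′ with ∈-++⁻ (z ∷ as) (subst (x ∈_) eq′ x∈t′)
    ...   | inj₁ x∈as         = inj₂ (subst (x ∈_) (sym eq) (∈-++⁺ˡ x∈as))
    ...   | inj₂ (here x≡y)   = inj₁ x≡y
    ...   | inj₂ (there x∈bs) = inj₂ (subst (x ∈_) (sym eq) (∈-++⁺ʳ (z ∷ as) x∈bs))

  -- Passes the invariant `min t ≺ just y` on to a right subtree; freshness of `y` excludes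
  -- equality.
  y⊀r⇒r≺y : ∀ {y i j} (l : Tree i) (r : Tree j) →
            just y ∉ contents l ++ contents r → ¬ (just y ≺ min r) → min r ≺ just y
  y⊀r⇒r≺y l r y∉ = ⊀⇒≺ λ y≡r →
    y∉ (∈-++⁺ʳ (contents l) (subst (_∈ contents r) (sym y≡r) (min∈ r)))

  Sorted-insert : ∀ {y j} {t t′ : Tree (suc j)} {D} → Insert y t t′ D →
    Sorted (contents t) → just y ∉ contents t → min t ≺ just y → Sorted (contents t′)
  Sorted-insert new _ _ x≺y = (x≺y ∷ []) ∷ [] ∷ []
  Sorted-insert (keep ins _) = Sorted-insert ins
  Sorted-insert (split {t′ = t′} ins full) t↗ y∉ m≺y =
    subst Sorted (sym (contents-split t′ full)) (Sorted-insert ins t↗ y∉ m≺y)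
  Sorted-insert {y} (left {l = l} {l′} {r} y≺r ins) t↗ y∉ m≺y with Sorted-++⁻ (contents l) t↗
  ... | l↗ , r↗ , l≺r = Sorted-++⁺ (Sorted-insert ins l↗ (y∉ ∘ ∈-++⁺ˡ) m≺y) r↗ l′≺r
    where
    l′≺r : ∀ {x z} → x ∈ contents l′ → z ∈ contents r → x ≺ z
    l′≺r x∈ z∈ with ∈-insert⁻ ins x∈ | min-least r r↗ z∈
    ... | inj₂ x∈l  | _         = l≺r x∈l z∈
    ... | inj₁ refl | inj₁ refl = y≺r
    ... | inj₁ refl | inj₂ r≺z  = ≺-trans y≺r r≺z
  Sorted-insert {y} (right {l = l} {r} {r′} y⊀r ins) t↗ y∉ m≺y with Sorted-++⁻ (contents l) t↗
  ... | l↗ , r↗ , l≺r = Sorted-++⁺ l↗ (Sorted-insert ins r↗ (y∉ ∘ ∈-++⁺ʳ (contents l)) r≺y) l≺r′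
    where
    r≺y : min r ≺ just y
    r≺y = y⊀r⇒r≺y l r y∉ y⊀r
    l≺r′ : ∀ {x z} → x ∈ contents l → z ∈ contents r′ → x ≺ z
    l≺r′ x∈ z∈ with ∈-insert⁻ ins z∈
    ... | inj₁ refl = ≺-trans (l≺r x∈ (min∈ r)) r≺y
    ... | inj₂ z∈r  = l≺r x∈ z∈r

  Good-insert : ∀ {y j} {t t′ : Tree (suc j)} {D} → Insert y t t′ D → Good t → Good t′
  Good-insert new (bucket _ _ _) = node (full-bucket _ refl key) (full-bucket _ refl key)
  Good-insert {j = suc j} (keep {t′ = t′} ins ¬full) (bucket w≤ <2w g) = bucket
    (subst (weight (suc j) ≤_) (sym (size-insert ins)) (ℕ.m≤n⇒m≤1+n w≤))
    -- One more element makes at most twice the weight, and `¬full` excludes equality.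
    (ℕ.≤∧≢⇒< (subst (_≤ weight (suc j) + weight (suc j)) (sym (size-insert ins)) <2w) ¬full)
    (Good-insert ins g)
  Good-insert {j = suc j} (split {t′ = t′} ins full) _ =
    node (Good-bucket (suc j) _ (length-take-+ w w (contents t′) full))
         (Good-bucket (suc j) _ (length-drop-+ w w (contents t′) full))
    where w = weight (suc j)
  Good-insert (left  _ ins) (node gl gr) = node (Good-insert ins gl) gr
  Good-insert (right _ ins) (node gl gr) = node gl (Good-insert ins gr)

  inserted-dirty : ∀ {y j} {t t′ : Tree (suc j)} {D} → Insert y t t′ D → just y ∈ D
  inserted-dirty new         = here refl
  inserted-dirty (keep ins _)  = inserted-dirty ins
  inserted-dirty (split ins _) = ∈-insert⁺ ins (inj₁ refl)
  inserted-dirty (left  _ ins) = inserted-dirty ins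
  inserted-dirty (right _ ins) = inserted-dirty ins

  -- The separators on the search path of an old key stay the same, and a leaf that becomes a node
  -- leaves its old key at the left end, so only rebuilt buckets move keys; their contents lie in
  -- `D`.
  label-insert : ∀ {y j} {t t′ : Tree (suc j)} {D} → Insert y t t′ D →
    Sorted (contents t) → just y ∉ contents t → min t ≺ just y →
    ∀ h o {x} → just x ∈ contents t → just x ∉ D → label h o t′ x ≡ label h o t x
  label-insert {y} new _ _ (just x<y) h o {x} (here refl) _ with x ℤ.<? y
  ... | yes _   = refl
  ... | no  x≮y = contradiction x<y x≮y
  label-insert (keep ins _) t↗ y∉ m≺y h o = label-insert ins t↗ y∉ m≺y h o
  label-insert (split ins _) _ _ _ _ _ x∈ x∉D = contradiction (∈-insert⁺ ins (inj₂ x∈)) x∉D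
  label-insert (left {l = l} {r = r} y≺r ins) t↗ y∉ m≺y h o {x} x∈ x∉D with Sorted-++⁻ (contents l) t↗
  ... | l↗ , r↗ , l≺r with just x ≺? min r | locate l r t↗ x∈
  ...   | no _    | _                = refl
  ...   | yes _   | inj₁ (_ , x∈l)   = label-insert ins l↗ (y∉ ∘ ∈-++⁺ˡ) m≺y (pred h) o x∈l x∉D
  ...   | yes x≺r | inj₂ (x⊀r , _)   = contradiction x≺r x⊀r
  label-insert (right {l = l} {r = r} y⊀r ins) t↗ y∉ m≺y h o {x} x∈ x∉D
    -- The separator `min r′` equals `min r`, so every key takes the same turn as before.
    rewrite min-insert ins with Sorted-++⁻ (contents l) t↗
  ... | l↗ , r↗ , l≺r with just x ≺? min r | locate l r t↗ x∈
  ...   | yes _   | _                = refl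
  ...   | no _    | inj₂ (_ , x∈r)   = label-insert ins r↗ (y∉ ∘ ∈-++⁺ʳ (contents l)) (y⊀r⇒r≺y l r y∉ y⊀r) (pred h) (o + 2 ^ pred h) x∈r x∉D
  ...   | no x⊀r  | inj₁ (x≺r , _)   = contradiction x≺r x⊀r

  -- The new key pays 1, and each of the `j` buckets of positive level on its path receives 2. Under
  -- `keep` these are saved; under `split` they complete the savings to the size of the rebuilt
  -- bucket.
  cost-insert : ∀ {y j} {t t′ : Tree (suc j)} {D} → Insert y t t′ D → Good t →
                length D + potential t′ ≤ potential t + suc (2 * j)
  cost-insert new _ = ℕ.≤-refl
  cost-insert {j = suc j} (keep {t = t} {t′} {D} ins _) (bucket w≤ _ g) = begin
    length D + (2 * (size t′ ∸ w) + potential t′)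
      ≡⟨ cong (λ z → length D + (2 * z + potential t′))
           (trans (cong (_∸ w) (size-insert ins)) (ℕ.+-∸-assoc 1 w≤)) ⟩
    length D + (2 * suc e + potential t′)
      ≡⟨ pull (length D) e (potential t′) ⟩
    2 * suc e + (length D + potential t′)
      ≤⟨ ℕ.+-monoʳ-≤ (2 * suc e) (cost-insert ins g) ⟩
    2 * suc e + (potential t + suc (2 * j))
      ≡⟨ regroup e (potential t) j ⟩
    (2 * e + potential t) + suc (2 * suc j) ∎
    where
    open ℕ.≤-Reasoning
    w = weight (suc j)
    e = size t ∸ w
    pull : ∀ d e p → d + (2 * suc e + p) ≡ 2 * suc e + (d + p)
    pull = solve-∀
    regroup : ∀ e p j → 2 * suc e + (p + suc (2 * j)) ≡ (2 * e + p) + suc (2 * suc j)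
    regroup = solve-∀
  cost-insert {j = suc j} (split {t = t} {t′} ins full) (bucket w≤ _ g) = begin
    size t′ + (potential (bucket (build (suc j) (take w (contents t′)))) +
               potential (bucket (build (suc j) (drop w (contents t′)))))
      ≡⟨ cong (λ z → size t′ + z) (cong₂ _+_
           (potential-bucket (suc j) _ (length-take-+ w w (contents t′) full))
           (potential-bucket (suc j) _ (length-drop-+ w w (contents t′) full))) ⟩
    size t′ + 0
      ≡⟨ ℕ.+-identityʳ (size t′) ⟩
    size t′
      ≡⟨ full ⟩
    w + w
      ≡⟨ cong (λ z → z + z) (sym 1+e≡w) ⟩
    suc e + suc e
      -- The savings inside the bucket are given up, together with the payments for the lower
      -- levels.
      ≤⟨ ℕ.m≤m+n (suc e + suc e) (potential t + suc (2 * j)) ⟩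
    suc e + suc e + (potential t + suc (2 * j))
      ≡⟨ regroup e (potential t) j ⟩
    (2 * e + potential t) + suc (2 * suc j) ∎
    where
    open ℕ.≤-Reasoning
    w = weight (suc j)
    e = size t ∸ w
    -- Just before the split the bucket holds `2 * w - 1` elements, so its excess is `w - 1`.
    1+e≡w : suc e ≡ w
    1+e≡w = trans (sym (ℕ.+-∸-assoc 1 w≤))
      (trans (cong (_∸ w) (trans (sym (size-insert ins)) full)) (ℕ.m+n∸n≡m w w))
    regroup : ∀ e p j → suc e + suc e + (p + suc (2 * j)) ≡ (2 * e + p) + suc (2 * suc j)
    regroup = solve-∀
  cost-insert {j = j} (left {l = l} {l′} {r} {D} _ ins) (node gl _) = begin
    length D + (potential l′ + potential r)          ≡⟨ ℕ.+-assoc (length D) _ _ ⟨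
    length D + potential l′ + potential r            ≤⟨ ℕ.+-monoˡ-≤ (potential r) (cost-insert ins gl) ⟩
    potential l + suc (2 * j) + potential r          ≡⟨ swap (potential l) (suc (2 * j)) (potential r) ⟩
    potential l + potential r + suc (2 * j)          ∎
    where
    open ℕ.≤-Reasoning
    swap : ∀ a b c → a + b + c ≡ a + c + b
    swap = solve-∀
  cost-insert {j = j} (right {l = l} {r} {r′} {D} _ ins) (node _ gr) = begin
    length D + (potential l + potential r′)          ≡⟨ swap (length D) (potential l) (potential r′) ⟩
    potential l + (length D + potential r′)          ≤⟨ ℕ.+-monoʳ-≤ (potential l) (cost-insert ins gr) ⟩
    potential l + (potential r + suc (2 * j))        ≡⟨ ℕ.+-assoc (potential l) _ _ ⟨
    potential l + potential r + suc (2 * j)          ∎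
    where
    open ℕ.≤-Reasoning
    swap : ∀ a b c → a + (b + c) ≡ b + (a + c)
    swap = solve-∀

  -- The loading algorithm

  run : ∀ j → List ℤ → Tree (suc j)
  run j []       = build (suc j) (replicate (weight (suc j)) nothing)
  run j (y ∷ ys) = proj₁ (insert y (run j ys))

  record Stores {j} (ys : List ℤ) (t : Tree (suc j)) : Set where
    field
      good        : Good t
      size≡       : size t ≡ weight (suc j) + length ys
      sorted      : Sorted (contents t)
      min≡nothing : min t ≡ nothing
      ∈⁺          : ∀ {x} → x ∈ ys → just x ∈ contents t
      ∈⁻          : ∀ {x} → just x ∈ contents t → x ∈ ys

    -- The leftmost sentinel stays first forever, which starts the invariant required by the
    -- insertion lemmas.
    min≺ : ∀ {y} → min t ≺ just y
    min≺ = subst (_≺ _) (sym min≡nothing) -∞≺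

  open Stores

  run-stores : ∀ j {ys} → Unique ys → Stores ys (run j ys)
  run-stores j [] = record
    { good        = Good-build (suc j) sentinels length-sentinels
    ; size≡       = trans (size-build (suc j) sentinels length-sentinels) (sym (ℕ.+-identityʳ _))
    ; sorted      = subst Sorted (sym contents≡) (Sorted-replicate (weight (suc j)))
    ; min≡nothing = all-nothing (subst (min (run j []) ∈_) contents≡ (min∈ (run j [])))
    ; ∈⁺          = λ ()
    ; ∈⁻          = λ x∈ → contradiction (all-nothing (subst (_ ∈_) contents≡ x∈)) λ ()
    }
    where
    sentinels = replicate (weight (suc j)) nothing
    length-sentinels : length sentinels ≡ weight (suc j)
    length-sentinels = List.length-replicate (weight (suc j))
    contents≡ : contents (run j []) ≡ sentinels
    contents≡ = contents-build (suc j) sentinels length-sentinels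
    all-nothing : ∀ {x} → x ∈ sentinels → x ≡ nothing
    all-nothing = All.lookup (All.replicate⁺ {P = _≡ nothing} (weight (suc j)) refl)
  run-stores j {y ∷ ys} (y≢ys ∷ ys!) with insert y (run j ys) | run-stores j ys!
  ... | t′ , D , ins | s = record
    { good        = Good-insert ins (good s)
    ; size≡       = trans (size-insert ins) (trans (cong suc (size≡ s))
                      (sym (ℕ.+-suc (weight (suc j)) (length ys))))
    ; sorted      = Sorted-insert ins (sorted s) (All.All¬⇒¬Any y≢ys ∘ ∈⁻ s) (min≺ s)
    ; min≡nothing = trans (min-insert ins) (min≡nothing s)
    ; ∈⁺          = λ { (here refl) → ∈-insert⁺ ins (inj₁ refl)
                      ; (there x∈) → ∈-insert⁺ ins (inj₂ (∈⁺ s x∈)) }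
    ; ∈⁻          = λ x∈ → member (∈-insert⁻ ins x∈)
    }
    where
    member : ∀ {x} → just x ≡ just y ⊎ just x ∈ contents (run j ys) → x ∈ y ∷ ys
    member (inj₁ refl) = here refl
    member (inj₂ x∈)   = there (∈⁻ s x∈)

  algorithm : ∀ {m n} j → n < weight (suc j) → 2 ^ (2 * u * suc j) ≤ m → Algorithm n m
  algorithm {m} {n} j n<w 2^h≤m = record
    -- The offset is 1 because cells are numbered from 1; labels then range over `[1, 2 ^ h]`.
    { respond = λ ys → label h 1 (run j ys)
    ; storage = λ ys ys! ys≤n → record
      { inArray = λ {y} _ → let lo , hi = label-bounds h 1 (run j ys) (short ys! ys≤n) y in
                            lo , ℕ.≤-trans (s≤s⁻¹ hi) 2^h≤m
      ; mono    = λ x∈ y∈ → let s = run-stores j ys! in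
                            label-mono h 1 (run j ys) (short ys! ys≤n) (sorted s) (∈⁺ s x∈) (∈⁺ s y∈)
      }
    }
    where
    h = 2 * u * suc j
    short : ∀ {ys} → Unique ys → length ys ≤ n → height (run j ys) ≤ h
    short ys! ys≤n = let s = run-stores j ys! in
      -- The root holds `weight (suc j)` sentinels and fewer real keys than that, hence less than
      -- twice the weight.
      height≤ (good s) (subst (_< weight (suc j) + weight (suc j)) (sym (size≡ s))
        (ℕ.+-monoʳ-< (weight (suc j)) (ℕ.≤-<-trans ys≤n n<w)))

  -- Total cost against an adversary

  module _ {m n} j (n<w : n < weight (suc j)) (2^h≤m : 2 ^ (2 * u * suc j) ≤ m) (B : Adversary) where

    private
      A = algorithm {m} j n<w 2^h≤m

    Unique-keys-play : ∀ t → Unique (keys (play A B t))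
    Unique-keys-play zero    = []
    Unique-keys-play (suc t) = All.¬Any⇒All¬ _ (fresh B (play A B t)) ∷ Unique-keys-play t

    -- A stored key rules out the empty history, where `current` is a dummy.
    current-play : ∀ t {x} → x ∈ keys (play A B t) →
                   current (play A B t) x ≡ respond A (keys (play A B t)) x
    current-play (suc t) _ = refl

    totalCost-play : ∀ t →
      totalCost (play A B t) + potential (run j (keys (play A B t))) ≤ suc (2 * j) * t
    totalCost-play zero = ℕ.≤-trans
      (ℕ.≤-reflexive (potential-build (suc j) _ (List.length-replicate (weight (suc j))))) z≤n
    -- The result of the insertion gets a name while `respond` and `run` keep the call; `eq`
    -- reconnects them.
    totalCost-play (suc t) = step (insert y T) refl
      where
      h = play A B t
      y = select B h
      T = run j (keys h)
      s : Stores (keys h) T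
      s = run-stores j (Unique-keys-play t)
      step : ∀ p → insert y T ≡ p →
             totalCost (play A B (suc t)) + potential (run j (y ∷ keys h)) ≤ suc (2 * j) * suc t
      step (T′ , D , ins) eq = begin
        length R + totalCost h + potential (proj₁ (insert y T))
          ≡⟨ cong (λ p → length R + totalCost h + potential (proj₁ p)) eq ⟩
        length R + totalCost h + potential T′    ≤⟨ ℕ.+-monoˡ-≤ (potential T′) (ℕ.+-monoˡ-≤ (totalCost h) R≤D) ⟩
        length D + totalCost h + potential T′    ≡⟨ pull (length D) (totalCost h) (potential T′) ⟩
        totalCost h + (length D + potential T′)  ≤⟨ ℕ.+-monoʳ-≤ (totalCost h) (cost-insert ins (good s)) ⟩
        totalCost h + (potential T + suc (2 * j))  ≡⟨ ℕ.+-assoc (totalCost h) _ _ ⟨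
        totalCost h + potential T + suc (2 * j)  ≤⟨ ℕ.+-monoˡ-≤ (suc (2 * j)) (totalCost-play t) ⟩
        suc (2 * j) * t + suc (2 * j)            ≡⟨ ℕ.+-comm (suc (2 * j) * t) (suc (2 * j)) ⟩
        suc (2 * j) + suc (2 * j) * t            ≡⟨ ℕ.*-suc (suc (2 * j)) t ⟨
        suc (2 * j) * suc t                      ∎
        where
        open ℕ.≤-Reasoning
        f = respond A (y ∷ keys h)
        R = Rel y f h
        pull : ∀ d c p → d + c + p ≡ c + (d + p)
        pull = solve-∀
        moved : ∀ {x} → x ∈ y ∷ keys h × Relocated y f h x → just x ∈ D
        moved (_ , inj₁ refl) = inserted-dirty ins
        moved (here refl , inj₂ _) = inserted-dirty ins
        moved {x} (there x∈ , inj₂ fx≢) with just x ∈? D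
        ... | yes x∈D = x∈D
        -- A key outside `D` has the same label before and after, so it cannot have been relocated.
        ... | no  x∉D = contradiction
          (trans (cong (λ p → label _ 1 (proj₁ p) x) eq)
            (trans (label-insert ins (sorted s) (fresh B h ∘ ∈⁻ s) (min≺ s) _ 1 (∈⁺ s x∈) x∉D)
                   (sym (current-play t x∈))))
          fx≢
        R≤D : length R ≤ length D
        -- The entries of `R` are distinct since the adversary's keys are fresh; `just` embeds them
        -- into `D`.
        R≤D = subst (_≤ length D) (List.length-map just R) (Unique-⊆⇒length≤
          (Unique.map⁺ just-injective (Unique.filter⁺ (relocated? y f h) (Unique-keys-play (suc t))))
          λ x∈ → let z , z∈R , x≡z = ∈-map⁻ just x∈ in
            subst (_∈ D) (sym x≡z) (moved (∈-filter⁻ (relocated? y f h) z∈R)))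

  achievable : ∀ {m n} j → n < weight (suc j) → 2 ^ (2 * u * suc j) ≤ m →
               Achievable n m (suc (2 * j) * n)
  achievable {n = n} j n<w 2^h≤m = algorithm j n<w 2^h≤m ,
    λ B → ℕ.≤-trans (ℕ.m≤m+n _ _) (totalCost-play j n<w 2^h≤m B n)

theorem14 : (m k n : ℕ) →
    2 ^ 16 < m →
    1 ≤ k →
    fromℕ k ≤ʳ ½* √ (log₂ (fromℚ (fromℕ m)) ÷ʳ log₂ (log₂ (fromℚ (fromℕ m)))) →
    1 ≤ n →
    fromℕ n ≤ʳ log₂ (fromℚ (fromℕ m)) ^[ k / 3 ] →
    (∀ c → Isχ n m c → c ≤ (2 * k ∸ 1) * n) × Achievable n m ((2 * k ∸ 1) * n)
theorem14 m (suc j) n 2^16<m 1≤k k≤ 1≤n n≤ = (λ c isχ → proj₂ isχ _ loads) , loads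
  where
  loads : Achievable n m ((2 * suc j ∸ 1) * n)
  loads = let u , n<rᵏ , 2^2uk≤m = parameters 2^16<m 1≤k k≤ 1≤n n≤ in
    -- `2 * suc j ∸ 1` computes to `j + suc (j + 0)`, and `suc (2 * j)` to `suc (j + (j + 0))`.
    subst (λ c → Achievable n m (c * n)) (sym (ℕ.+-suc j (j + 0)))
      (Loading.achievable u j n<rᵏ 2^2uk≤m)
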